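{- (1) Every PP-rich set in $(\mathbb{N},+)$ contains a family of $2^\omega$ almost disjoint subsets each of which is PP-rich. (2) Every PP-rich set in $(\mathbb{N},+)$ can be split into $\omega$ pairwise disjoint subsets each of which is PP-rich.
   Context: $\mathbb{N}=\{1,2,\dots\}$. $\mathbb{P}$ denotes the set of polynomials with coefficients in $\mathbb{N}\cup\{0\}$ and zero constant term which map $\mathbb{N}$ into $\mathbb{N}$; $\mathcal{P}_f(\mathbb{P})$ is the set of nonempty finite subsets of $\mathbb{P}$. $A\subseteq\mathbb{N}$ is PP-rich if for every $R\in\mathcal{P}_f(\mathbb{P})$ there exist $a,x\in\mathbb{N}$ with $\{a+f(x): f\in R\}\subseteq A$. For an infinite set $X$, a family of almost disjoint subsets of $X$ consists of subsets of $X$ of cardinality $|X|$ any two distinct of which meet in a set of cardinality less than $|X|$. -}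

module Defs where

open import Level using (Level; 0ℓ; _⊔_)
open import Data.List.Base using (List; []; _∷_; foldr)
open import Data.List.NonEmpty.Base using (List⁺)
open import Data.List.NonEmpty.Relation.Unary.All using (All)
open import Data.Nat.Base using (ℕ; _+_; _*_; _<_)
open import Data.Product.Base using (∃₂; _×_; proj₁)
open import Function.Bundles using (Bijection; Injection)
open import Relation.Binary.Bundles using (Setoid)
import Relation.Binary.Construct.On as On
open import Relation.Binary.PropositionalEquality using (_≡_; setoid)
open import Relation.Nullary using (¬_)
open import Relation.Unary using (Pred; _∈_; _⊆_; _∩_; _≐_)

private
  variable
    i ℓ ℓ₁ ℓ₂ : Level

-- The natural numbers of the theory start at 1.
ℕ⁺ : Pred ℕ 0ℓ
ℕ⁺ n = 0 < n

-- A coefficient list c₀ ∷ c₁ ∷ … stands for c₀ + c₁ x + c₂ x² + …, evaluated by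
-- Horner's rule.
eval : List ℕ → ℕ → ℕ
eval cs x = foldr (λ c r → c + x * r) 0 cs

constantTerm : List ℕ → ℕ
constantTerm []      = 0
constantTerm (c ∷ _) = c

-- Trailing zeros are allowed, so one polynomial has several representatives;
-- every notion below depends only on the values of the polynomials.
record ℙ : Set where
  field
    coeffs           : List ℕ
    zeroConstantTerm : constantTerm coeffs ≡ 0
    mapsℕ⁺toℕ⁺       : ∀ {x} → x ∈ ℕ⁺ → eval coeffs x ∈ ℕ⁺

⟦_⟧ : ℙ → ℕ → ℕ
⟦ f ⟧ = eval (ℙ.coeffs f)

-- Nonempty finite sets of polynomials are given by nonempty lists of their elements.
PPRich : Pred ℕ ℓ → Set ℓ
PPRich A = (R : List⁺ ℙ) →
  ∃₂ λ a x → a ∈ ℕ⁺ × x ∈ ℕ⁺ × All (λ f → a + ⟦ f ⟧ x ∈ A) R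

-- The elements of a set of numbers. They are compared as numbers: membership
-- proofs are ignored, so that cardinalities do not count them.
Elements : Pred ℕ ℓ → Setoid ℓ 0ℓ
Elements X = On.setoid (setoid ℕ) (proj₁ {B = X})

-- |X| = |Y|
_≈ᶜ_ : Pred ℕ ℓ₁ → Pred ℕ ℓ₂ → Set (ℓ₁ ⊔ ℓ₂)
X ≈ᶜ Y = Bijection (Elements X) (Elements Y)

-- |X| ≤ |Y|
_≼ᶜ_ : Pred ℕ ℓ₁ → Pred ℕ ℓ₂ → Set (ℓ₁ ⊔ ℓ₂)
X ≼ᶜ Y = Injection (Elements X) (Elements Y)

-- |X| < |Y|
_≺ᶜ_ : Pred ℕ ℓ₁ → Pred ℕ ℓ₂ → Set (ℓ₁ ⊔ ℓ₂)
X ≺ᶜ Y = X ≼ᶜ Y × ¬ (Y ≼ᶜ X)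

-- Repetitions in the indexing are harmless: the last condition concerns
-- members that are distinct as sets.
record AlmostDisjoint {I : Set i} (X : Pred ℕ ℓ₁) (F : I → Pred ℕ ℓ₂) : Set (i ⊔ ℓ₁ ⊔ ℓ₂) where
  field
    subsets      : ∀ s → F s ⊆ X
    cardinality  : ∀ s → F s ≈ᶜ X
    intersection : ∀ s t → ¬ (F s ≐ F t) → (F s ∩ F t) ≺ᶜ X

{-# OPTIONS --safe #-}

-- By finitely many applications of richness to a universal finite set of polynomials
-- one finds in A finite blocks, each lying above the preceding ones, such that the
-- union of infinitely many blocks is always PP-rich. For (1), label the finite binary
-- words injectively by natural numbers and let F σ be the union of the blocks
-- labelled by the prefixes of σ: two branches share only finitely many prefixes. For
-- (2), partition the indices of the blocks into infinitely many infinite classes and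
-- add the points outside of all the blocks to one of the parts.
module Submission where

open import Defs
open import Data.Bool.Base using (Bool; true; false)
open import Data.Bool.Properties using () renaming (_≟_ to _≟ᴮ_)
open import Data.Fin.Base using (Fin; toℕ)
open import Data.Fin.Properties using (injective⇒≤; toℕ-injective)
open import Data.List.Base
  using (List; []; _∷_; map; upTo; cartesianProductWith; concatMap; length)
open import Data.List.Extrema.Nat using (max; xs≤max)
open import Data.List.Membership.Propositional using () renaming (_∈_ to _∈ₗ_)
open import Data.List.Membership.DecPropositional using (_∈?_)
open import Data.List.Membership.Propositional.Properties
  using (∈-map⁺; ∈-map⁻; ∈-upTo⁺; ∈-concatMap⁺; ∈-cartesianProductWith⁺)
open import Data.List.Membership.Setoid.Properties using (index-injective)
import Data.List.NonEmpty.Base as List⁺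
open List⁺ using (List⁺)
import Data.List.NonEmpty.Relation.Unary.All as All⁺
import Data.List.Relation.Unary.All as All
import Data.List.Relation.Unary.All.Properties as All
open import Data.List.Relation.Unary.Any using (here; there; index)
import Data.List.Relation.Unary.Any as Any
open import Data.Nat.Base
open import Data.Nat.Properties renaming (_≟_ to _≟ᴺ_)
open import Data.Product.Base
  using (Σ-syntax; ∃; ∃₂; _×_; _,_; proj₁; proj₂; map₂)
open import Data.Sum.Base using (_⊎_; inj₁; inj₂)
open import Function.Base using (_∘_)
open import Function.Bundles using (module Injection)
open import Function.Definitions using (Congruent; Injective)
open import Level using (Level; Lift; lift)
open import Relation.Binary.Definitions using (tri<; tri≈; tri>)
open import Relation.Binary.PropositionalEquality
  using (_≡_; _≢_; _≗_; refl; sym; trans; cong; subst; setoid; module ≡-Reasoning)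
open import Relation.Nullary using (Dec; ¬_; yes; no; contradiction)
open import Relation.Nullary.Decidable using (map′; decidable-stable)
open import Relation.Unary using (Pred; Decidable; _∈_; _⊆_; _∩_; _≐_; _⊥_; ⋃)

private
  variable
    ℓ ℓ₁ ℓ₂ : Level

-- Polynomials

addConstant : ℕ → List ℕ → List ℕ
addConstant k []       = k ∷ []
addConstant k (c ∷ cs) = k + c ∷ cs

eval-addConstant : ∀ k cs x → eval (addConstant k cs) x ≡ k + eval cs x
eval-addConstant k []       x = cong (k +_) (*-zeroʳ x)
eval-addConstant k (c ∷ cs) x = +-assoc k c _

linear+ : ℕ → List ℕ → ℙ
linear+ k cs = record
  { coeffs           = 0 ∷ addConstant (suc k) cs
  ; zeroConstantTerm = refl
  ; mapsℕ⁺toℕ⁺       = λ {x} 0<x →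
      *-mono-≤ 0<x (subst (0 <_) (sym (eval-addConstant (suc k) cs x)) z<s)
  }

-- Bounds the length and every coefficient at once, so that each height admits only finitely many
-- lists.
height : List ℕ → ℕ
height []       = 0
height (c ∷ cs) = suc (c ⊔ height cs)

polys : ℕ → List (List ℕ)
polys zero    = [] ∷ []
polys (suc n) = [] ∷ cartesianProductWith _∷_ (upTo (suc n)) (polys n)

[]∈polys : ∀ n → [] ∈ₗ polys n
[]∈polys zero    = here refl
[]∈polys (suc n) = here refl

∈-polys : ∀ {n} cs → height cs ≤ n → cs ∈ₗ polys n
∈-polys []       _         = []∈polys _
∈-polys (c ∷ cs) (s≤s h≤n) = there (∈-cartesianProductWith⁺ _∷_
  (∈-upTo⁺ (s≤s (m⊔n≤o⇒m≤o c _ h≤n)))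
  (∈-polys cs (m⊔n≤o⇒n≤o c _ h≤n)))

-- As the constant term is zero, `x` factors out and the tail of the coefficient list is the
-- cofactor. Patterns can thus range over arbitrary cofactors `cs`, which `polys` enumerates.
ℙ-multiple : ∀ {n} (f : ℙ) → height (ℙ.coeffs f) ≤ n →
             ∃ λ cs → cs ∈ₗ polys n × (∀ x → ⟦ f ⟧ x ≡ x * eval cs x)
ℙ-multiple f h≤n with ℙ.coeffs f | ℙ.zeroConstantTerm f
... | []     | _    = [] , []∈polys _ , λ x → sym (*-zeroʳ x)
... | 0 ∷ cs | refl =
  cs , ∈-polys cs (≤-trans (n≤1+n _) h≤n) , λ _ → refl

All⁺-map : ∀ {P : Pred ℙ ℓ₁} {Q : Pred ℙ ℓ₂} → P ⊆ Q → All⁺.All P ⊆ All⁺.All Q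
All⁺-map P⊆Q (p All⁺.∷ ps) = P⊆Q p All⁺.∷ All.map P⊆Q ps

heightBound : (R : List⁺ ℙ) → ∃ λ m → All⁺.All (λ f → height (ℙ.coeffs f) ≤ m) R
heightBound (f List⁺.∷ fs)
  with p All.∷ ps ← All.map⁻ {xs = f ∷ fs} {f = height ∘ ℙ.coeffs} (xs≤max 0 _)
  = _ , p All⁺.∷ ps

-- Blocks

record Pattern (A : Pred ℕ ℓ) (N n : ℕ) : Set ℓ where
  field
    a x     : ℕ
    N<a     : N < a
    0<x     : 0 < x
    inside  : All.All (λ cs → a + x * eval cs x ∈ A) (polys n)

  elements : List ℕ
  elements = map (λ cs → a + x * eval cs x) (polys n)

-- Adding (N + 1) x to all polynomials pushes a up beyond N; it also makes them
-- positive, so that the zero polynomial may take part.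
findPattern : ∀ {A : Pred ℕ ℓ} → PPRich A → ∀ N n → Pattern A N n
findPattern {A = A} rich N n
  with a , x , 0<a , 0<x , _ All⁺.∷ ps
    ← rich (linear+ N [] List⁺.∷ map (linear+ N) (polys n))
  = record
  { a      = a + x * suc N
  ; x      = x
  ; N<a    = ≤-trans (m≤n*m (suc N) x {{>-nonZero 0<x}}) (m≤n+m _ a)
  ; 0<x    = 0<x
  ; inside = All.map (λ {cs} → subst A (value cs)) (All.map⁻ ps)
  }
  where
  open ≡-Reasoning
  value : ∀ cs → a + ⟦ linear+ N cs ⟧ x ≡ a + x * suc N + x * eval cs x
  value cs = begin
    a + x * eval (addConstant (suc N) cs) x  ≡⟨ cong (λ e → a + x * e) (eval-addConstant (suc N) cs x) ⟩
    a + x * (suc N + eval cs x)              ≡⟨ cong (a +_) (*-distribˡ-+ x (suc N) _) ⟩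
    a + (x * suc N + x * eval cs x)          ≡⟨ +-assoc a _ _ ⟨
    a + x * suc N + x * eval cs x            ∎

-- The interface shared by both halves. `above` bounds the index of a block by its elements, so that
-- looking for the block of a given number is a finite search.
record Blocks (A : Pred ℕ ℓ) : Set ℓ where
  field
    block    : ℕ → List ℕ
    inside   : ∀ n {y} → y ∈ₗ block n → y ∈ A
    nonempty : ∀ n → ∃ λ y → y ∈ₗ block n
    above    : ∀ {n y} → y ∈ₗ block n → n < y
    disjoint : ∀ {m n y} → y ∈ₗ block m → y ∈ₗ block n → m ≡ n
    rich     : ∀ R → ∃ λ m → ∀ {n} → m ≤ n →
               ∃₂ λ a x → a ∈ ℕ⁺ × x ∈ ℕ⁺ × All⁺.All (λ f → a + ⟦ f ⟧ x ∈ₗ block n) R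

  -- All blocks from some index on serve a given `R`, and `P` contains one of these.
  cofinal⇒rich : ∀ {P : Pred ℕ ℓ₁} →
                 (∀ m → ∃ λ n → m ≤ n × (∀ {y} → y ∈ₗ block n → y ∈ P)) → PPRich P
  cofinal⇒rich cofinal R
    with m , big ← rich R
    with n , m≤n , block⊆P ← cofinal m
    with a , x , 0<a , 0<x , ps ← big m≤n
    = a , x , 0<a , 0<x , All⁺-map block⊆P ps

module Construction {A : Pred ℕ ℓ} (rich : PPRich A) where

  -- Mutual recursion: each pattern starts beyond the maximum of the block before it. Since the
  -- bounds increase, it then lies beyond all earlier blocks.
  bound     : ℕ → ℕ
  patternAt : ∀ n → Pattern A (bound n) n

  bound zero    = 0
  bound (suc n) = max 0 (Pattern.elements (patternAt n))

  patternAt n = findPattern rich (bound n) n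

  open module P n = Pattern (patternAt n)

  block : ℕ → List ℕ
  block n = elements n

  bound< : ∀ n {y} → y ∈ₗ block n → bound n < y
  bound< n y∈
    with cs , _ , refl ← ∈-map⁻ (λ cs → a n + x n * eval cs (x n)) y∈
    = ≤-trans (N<a n) (m≤m+n (a n) _)

  ≤bound : ∀ n {y} → y ∈ₗ block n → y ≤ bound (suc n)
  ≤bound n = All.lookup (xs≤max 0 (block n))

  nonempty : ∀ n → ∃ λ y → y ∈ₗ block n
  nonempty n = _ , ∈-map⁺ _ ([]∈polys n)

  bound-step : ∀ n → bound n < bound (suc n)
  bound-step n with y , y∈ ← nonempty n = <-≤-trans (bound< n y∈) (≤bound n y∈)

  n≤bound : ∀ n → n ≤ bound n
  n≤bound zero    = z≤n
  n≤bound (suc n) = ≤-<-trans (n≤bound n) (bound-step n)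

  bound-mono : ∀ {m n} → m ≤′ n → bound m ≤ bound n
  bound-mono (≤′-reflexive refl) = ≤-refl
  bound-mono (≤′-step {n} m≤n)   = ≤-trans (bound-mono m≤n) (<⇒≤ (bound-step n))

  -- A common element would be at most `bound (suc m)`, hence at most `bound n`, which all elements
  -- of block `n` exceed.
  ordered : ∀ {m n y} → m < n → y ∈ₗ block m → ¬ y ∈ₗ block n
  ordered {m} {n} m<n y∈m y∈n = <-irrefl refl
    (<-≤-trans (bound< n y∈n) (≤-trans (≤bound m y∈m) (bound-mono (≤⇒≤′ m<n))))

  disjoint : ∀ {m n y} → y ∈ₗ block m → y ∈ₗ block n → m ≡ n
  disjoint {m} {n} y∈m y∈n with <-cmp m n
  ... | tri< m<n _ _ = contradiction y∈n (ordered m<n y∈m)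
  ... | tri≈ _ m≡n _ = m≡n
  ... | tri> _ _ n<m = contradiction y∈m (ordered n<m y∈n)

  blocks : Blocks A
  blocks = record
    { block    = block
    ; inside   = λ n → All.lookup (All.map⁺ {P = A} (inside n))
    ; nonempty = nonempty
    ; above    = λ {n} y∈ → ≤-<-trans (n≤bound n) (bound< n y∈)
    ; disjoint = disjoint
    -- From the largest height in `R` on, `polys n` contains the cofactors of all members of `R`.
    ; rich     = λ R → let m , hs = heightBound R in m , λ {n} m≤n →
        a n , x n , ≤-trans z<s (N<a n) , 0<x n , All⁺-map (λ {f} h → contains n {f} (≤-trans h m≤n)) hs
    }
    where
    contains : ∀ n {f} → height (ℙ.coeffs f) ≤ n → a n + ⟦ f ⟧ (x n) ∈ₗ block n
    contains n {f} h≤n with cs , cs∈ , f≡ ← ℙ-multiple f h≤n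
      = subst (_∈ₗ block n) (cong (a n +_) (sym (f≡ (x n)))) (∈-map⁺ _ cs∈)

-- Injective labels

-- Appends a digit 1 or 2 to a bijective base-two numeral. Without a digit 0, words of different
-- lengths never get the same number.
digit : Bool → ℕ → ℕ
digit false n = suc (2 * n)
digit true  n = suc (suc (2 * n))

digit-injective : ∀ b c m n → digit b m ≡ digit c n → b ≡ c × m ≡ n
digit-injective false false m n eq = refl , *-cancelˡ-≡ m n 2 (suc-injective eq)
digit-injective true  true  m n eq = refl , *-cancelˡ-≡ m n 2 (suc-injective (suc-injective eq))
digit-injective false true  m n eq = contradiction (suc-injective eq) (even≢odd m n)
digit-injective true  false m n eq = contradiction (sym (suc-injective eq)) (even≢odd n m)

n<digit : ∀ b n → n < digit b n
n<digit false n = s≤s (m≤n*m n 2)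
n<digit true  n = s≤s (m≤n⇒m≤1+n (m≤n*m n 2))

code : (ℕ → Bool) → ℕ → ℕ
code σ zero    = 0
code σ (suc m) = digit (σ m) (code σ m)

m≤code : ∀ σ m → m ≤ code σ m
m≤code σ zero    = z≤n
m≤code σ (suc m) = ≤-<-trans (m≤code σ m) (n<digit (σ m) _)

code-cong : ∀ {σ τ} → σ ≗ τ → ∀ m → code σ m ≡ code τ m
code-cong σ≗τ zero    = refl
code-cong {σ} {τ} σ≗τ (suc m) rewrite σ≗τ m = cong (digit (τ m)) (code-cong σ≗τ m)

-- Parity reveals the last bit, which is then stripped; 0 is the code of the empty prefix only.
code-injective : ∀ σ τ m n → code σ m ≡ code τ n →
                 m ≡ n × (∀ {k} → k < m → σ k ≡ τ k)
code-injective σ τ zero    zero    eq = refl , λ ()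
code-injective σ τ zero    (suc n) eq = contradiction eq (<⇒≢ (m<n⇒0<n (n<digit (τ n) _)))
code-injective σ τ (suc m) zero    eq = contradiction (sym eq) (<⇒≢ (m<n⇒0<n (n<digit (σ m) _)))
code-injective σ τ (suc m) (suc n) eq
  with σm≡τn , eq′ ← digit-injective (σ m) (τ n) (code σ m) (code τ n) eq
  with refl , agree ← code-injective σ τ m n eq′
  = refl , λ k<1+m → agree′ (m<1+n⇒m<n∨m≡n k<1+m)
  where
  agree′ : ∀ {k} → k < m ⊎ k ≡ m → σ k ≡ τ k
  agree′ (inj₁ k<m)  = agree k<m
  agree′ (inj₂ refl) = σm≡τn

-- Satisfies `pair i m + 2 = 2^i * (2 * m + 3)`, so `i` is the exponent of 2 in `pair i m + 2`. Each
-- `i` thus has its own infinite class of indices.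
pair : ℕ → ℕ → ℕ
pair zero    m = digit false m
pair (suc i) m = digit true (pair i m)

pair-injectiveˡ : ∀ i j {m n} → pair i m ≡ pair j n → i ≡ j
pair-injectiveˡ zero    zero    eq = refl
pair-injectiveˡ zero    (suc j) {m} {n} eq with () ← proj₁ (digit-injective false true m (pair j n) eq)
pair-injectiveˡ (suc i) zero    {m} {n} eq with () ← proj₁ (digit-injective true false (pair i m) n eq)
pair-injectiveˡ (suc i) (suc j) {m} {n} eq =
  cong suc (pair-injectiveˡ i j (proj₂ (digit-injective true true (pair i m) (pair j n) eq)))

i≤pair : ∀ i m → i ≤ pair i m
i≤pair zero    m = z≤n
i≤pair (suc i) m = ≤-<-trans (i≤pair i m) (n<digit true _)

m≤pair : ∀ i m → m ≤ pair i m
m≤pair zero    m = <⇒≤ (n<digit false m)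
m≤pair (suc i) m = ≤-trans (m≤pair i m) (<⇒≤ (n<digit true _))

-- Cardinalities

module Counting {P : Pred ℕ ℓ} (P? : Decidable P) (unbounded : ∀ n → ∃ λ y → n ≤ y × y ∈ P) where

  step : ∀ {n} → Dec (n ∈ P) → ℕ → ℕ
  step (yes _) c = suc c
  step (no  _) c = c

  count : ℕ → ℕ
  count zero    = 0
  count (suc n) = step (P? n) (count n)

  count-∈ : ∀ {n} → n ∈ P → count (suc n) ≡ suc (count n)
  count-∈ {n} n∈P with P? n
  ... | yes _  = refl
  ... | no n∉P = contradiction n∈P n∉P

  count-∉ : ∀ {n} → ¬ n ∈ P → count (suc n) ≡ count n
  count-∉ {n} n∉P with P? n
  ... | yes n∈P = contradiction n∈P n∉P
  ... | no _    = refl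

  count-step : ∀ n → count n ≤ count (suc n)
  count-step n with P? n
  ... | yes _ = n≤1+n _
  ... | no  _ = ≤-refl

  count-mono : ∀ {m n} → m ≤′ n → count m ≤ count n
  count-mono (≤′-reflexive refl) = ≤-refl
  count-mono (≤′-step m≤n)       = ≤-trans (count-mono m≤n) (count-step _)

  count-< : ∀ {m n} → m ∈ P → m < n → count m < count n
  count-< {n = n} m∈P m<n = subst (_≤ count n) (count-∈ m∈P) (count-mono (≤⇒≤′ m<n))

  count-injective : ∀ {m n} → m ∈ P → n ∈ P → count m ≡ count n → m ≡ n
  count-injective {m} {n} m∈P n∈P eq with <-cmp m n
  ... | tri< m<n _ _ = contradiction eq (<⇒≢ (count-< m∈P m<n))
  ... | tri≈ _ m≡n _ = m≡n
  ... | tri> _ _ n<m = contradiction (sym eq) (<⇒≢ (count-< n∈P n<m))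

  -- Upward search from `n`; the known member `k + n` guarantees termination, and the nonmembers
  -- passed on the way leave `count` unchanged.
  next : ∀ k n → k + n ∈ P → ∃ λ y → y ∈ P × count y ≡ count n
  next zero    n n∈P = n , n∈P , refl
  next (suc k) n p with P? n
  ... | yes n∈P = n , n∈P , refl
  ... | no  n∉P with y , y∈P , eq ← next k (suc n) (subst P (sym (+-suc k n)) p)
      = y , y∈P , trans eq (count-∉ n∉P)

  next-from : ∀ n → ∃ λ y → y ∈ P × count y ≡ count n
  next-from n with y , n≤y , y∈P ← unbounded n
    = next (y ∸ n) n (subst P (sym (m∸n+n≡m n≤y)) y∈P)

  count-surjective : ∀ c → ∃ λ y → y ∈ P × count y ≡ c
  count-surjective zero    = next-from 0
  count-surjective (suc c)
    with x , x∈P , refl ← count-surjective c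
    -- The first member after `x` has the next rank: only `x` itself is added to the count.
    with y , y∈P , eq ← next-from (suc x)
    = y , y∈P , trans eq (count-∈ x∈P)

  -- A member is sent to its rank, the number of smaller members, shifted by one because `ℕ⁺` starts
  -- at 1. Decidability makes ranks computable; unboundedness makes every rank occur.
  ≈ᶜℕ⁺ : P ≈ᶜ ℕ⁺
  ≈ᶜℕ⁺ = record
    { to        = λ (y , _) → suc (count y) , z<s
    ; cong      = cong (suc ∘ count)
    ; bijective =
        (λ {x} {y} eq → count-injective (proj₂ x) (proj₂ y) (suc-injective eq)) ,
        λ { (suc c , _) → let y , y∈P , eq = count-surjective c in
              (y , y∈P) , λ { refl → cong suc eq } }
    }

⊆⇒≼ᶜ : ∀ {X : Pred ℕ ℓ₁} {Y : Pred ℕ ℓ₂} → X ⊆ Y → X ≼ᶜ Y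
⊆⇒≼ᶜ X⊆Y = record
  { to        = map₂ X⊆Y
  ; cong      = λ eq → eq
  ; injective = λ eq → eq
  }

-- Pigeonhole: the images of the first `suc (length xs)` positive numbers would occupy distinct
-- positions in `xs`.
listed⇒ℕ⁺⋠ᶜ : ∀ {X : Pred ℕ ℓ} (xs : List ℕ) → (∀ {y} → y ∈ X → y ∈ₗ xs) → ¬ ℕ⁺ ≼ᶜ X
listed⇒ℕ⁺⋠ᶜ {X = X} xs listed inj = <-irrefl refl (injective⇒≤ position-injective)
  where
  open Injection inj
  value : ℕ → ∃ X
  value n = to (suc n , z<s)

  position : Fin (suc (length xs)) → Fin (length xs)
  position i = index (listed (proj₂ (value (toℕ i))))

  position-injective : Injective _≡_ _≡_ position
  position-injective {i} {j} eq = toℕ-injective (suc-injective (injective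
    (index-injective (setoid ℕ)
      (listed (proj₂ (value (toℕ i)))) (listed (proj₂ (value (toℕ j)))) eq)))

-- Almost disjoint rich subsets, indexed by infinite binary sequences

module AlmostDisjointFamily {A : Pred ℕ ℓ} (A⊆ℕ⁺ : A ⊆ ℕ⁺) (B : Blocks A) where
  open Blocks B

  Branch : (ℕ → Bool) → Pred ℕ _
  Branch σ y = ∃ λ m → y ∈ₗ block (code σ m)

  -- `Lift` only moves the branch to the universe level of `A`.
  F : (ℕ → Bool) → Pred ℕ ℓ
  F σ y = Lift ℓ (Branch σ y)

  F-mono : ∀ {σ τ} → σ ≗ τ → F σ ⊆ F τ
  F-mono σ≗τ {y} (lift (m , y∈)) =
    lift (m , subst (λ n → y ∈ₗ block n) (code-cong σ≗τ m) y∈)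

  F-cong : Congruent _≗_ _≐_ F
  F-cong σ≗τ = F-mono σ≗τ , F-mono (sym ∘ σ≗τ)

  -- Disjointness of the blocks makes the two labels equal, and a label determines its prefix.
  agree : ∀ {σ τ m n y} → y ∈ₗ block (code σ m) → y ∈ₗ block (code τ n) →
          ∀ {k} → k < m → σ k ≡ τ k
  agree {σ} {τ} {m} {n} p q = proj₂ (code-injective σ τ m n (disjoint p q))

  F-injective : Injective _≗_ _≐_ F
  F-injective {σ} {τ} (Fσ⊆Fτ , _) k
    -- The prefix of length `suc k` is the shortest one that records the bit `σ k`.
    with y , y∈ ← nonempty (code σ (suc k))
    with lift (n , y∈′) ← Fσ⊆Fτ (lift (suc k , y∈))
    = agree {σ} {τ} {suc k} {n} y∈ y∈′ ≤-refl

  F⊆A : ∀ σ → F σ ⊆ A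
  F⊆A σ (lift (m , y∈)) = inside (code σ m) y∈

  -- Elements of a block exceed its label, which is at least the prefix length, so only prefixes
  -- shorter than `y` need be searched.
  F? : ∀ σ → Decidable (F σ)
  F? σ y = map′
    (λ (m , _ , y∈) → lift (m , y∈))
    (λ (lift (m , y∈)) → m , ≤-<-trans (m≤code σ m) (above y∈) , y∈)
    (anyUpTo? (λ m → _∈?_ _≟ᴺ_ y (block (code σ m))) y)

  F-unbounded : ∀ σ n → ∃ λ y → n ≤ y × y ∈ F σ
  F-unbounded σ n with y , y∈ ← nonempty (code σ n)
    = y , <⇒≤ (≤-<-trans (m≤code σ n) (above y∈)) , lift (n , y∈)

  F-rich : ∀ σ → PPRich (F σ)
  F-rich σ = cofinal⇒rich λ m → code σ m , m≤code σ m , λ y∈ → lift (m , y∈)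

  -- Branches that part at k only share blocks labelled by prefixes of length at most k.
  parting⇒ℕ⁺⋠ᶜ : ∀ {σ τ} k → σ k ≢ τ k → ¬ ℕ⁺ ≼ᶜ (F σ ∩ F τ)
  parting⇒ℕ⁺⋠ᶜ {σ} {τ} k σk≢τk = listed⇒ℕ⁺⋠ᶜ (concatMap (block ∘ code σ) (upTo (suc k)))
    λ (lift (m , p) , lift (n , q)) → ∈-concatMap⁺ (block ∘ code σ)
      (Any.map (λ { refl → p })
        (∈-upTo⁺ (s≤s (≮⇒≥ (σk≢τk ∘ agree {σ} {τ} {m} {n} p q)))))

  almostDisjoint : AlmostDisjoint ℕ⁺ F
  almostDisjoint = record
    { subsets      = λ σ → A⊆ℕ⁺ ∘ F⊆A σ
    ; cardinality  = λ σ → Counting.≈ᶜℕ⁺ (F? σ) (F-unbounded σ)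
    ; intersection = λ σ τ Fσ≭Fτ →
        ⊆⇒≼ᶜ (A⊆ℕ⁺ ∘ F⊆A σ ∘ proj₁) ,
        -- Distinctness of the sets supplies no explicit parting place. Instead, a large
        -- intersection excludes parting at any `k`; as equality of bits is decidable, the sequences
        -- agree everywhere and the sets coincide.
        λ ℕ⁺≼ → Fσ≭Fτ (F-cong λ k → decidable-stable (σ k ≟ᴮ τ k)
          λ σk≢τk → parting⇒ℕ⁺⋠ᶜ {σ} {τ} k σk≢τk ℕ⁺≼)
    }

-- Splitting into infinitely many rich parts

module Splitting {A : Pred ℕ ℓ} (B : Blocks A) where
  open Blocks B

  located? : ∀ y → Dec (∃ λ i → i < y × ∃ λ m → m < y × y ∈ₗ block (pair i m))
  located? y = anyUpTo? (λ i → anyUpTo? (λ m → _∈?_ _≟ᴺ_ y (block (pair i m))) y) y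

  colour : ℕ → ℕ
  colour y with located? y
  ... | yes (i , _) = i
  -- Numbers in no block of the form `block (pair i m)` default to colour 0, so that the parts cover
  -- all of `A`.
  ... | no  _       = 0

  -- The search may return another pair, but disjoint blocks force equal indices, and `pair`
  -- determines its first argument. The search succeeds because `i` and `m` are at most `pair i m`,
  -- which is below `y`.
  colour-block : ∀ i m {y} → y ∈ₗ block (pair i m) → colour y ≡ i
  colour-block i m {y} y∈ with located? y
  ... | yes (j , _ , n , _ , y∈′) = pair-injectiveˡ j i (disjoint y∈′ y∈)
  ... | no ∄ = contradiction
    (i , ≤-<-trans (i≤pair i m) (above y∈) , m , ≤-<-trans (m≤pair i m) (above y∈) , y∈) ∄

  Part : ℕ → Pred ℕ ℓ
  Part i y = y ∈ A × colour y ≡ i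

  Part-disjoint : ∀ i j → i ≢ j → Part i ⊥ Part j
  Part-disjoint i j i≢j ((_ , c≡i) , (_ , c≡j)) = i≢j (trans (sym c≡i) c≡j)

  ⋃Part≐A : ⋃ ℕ Part ≐ A
  ⋃Part≐A = (λ (_ , y∈A , _) → y∈A) , (λ y∈A → _ , y∈A , refl)

  Part-rich : ∀ i → PPRich (Part i)
  Part-rich i = cofinal⇒rich {P = Part i} λ m →
    pair i m , m≤pair i m , λ y∈ → inside (pair i m) y∈ , colour-block i m y∈

theorem5p7 : ∀ {ℓ} →
    (∀ (A : Pred ℕ ℓ) → A ⊆ ℕ⁺ → PPRich A →
    Σ[ F ∈ ((ℕ → Bool) → Pred ℕ ℓ) ]
    Congruent _≗_ _≐_ F × Injective _≗_ _≐_ F ×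
    AlmostDisjoint ℕ⁺ F ×
    (∀ σ → F σ ⊆ A) × (∀ σ → PPRich (F σ)))
    ×
    (∀ (A : Pred ℕ ℓ) → A ⊆ ℕ⁺ → PPRich A →
    Σ[ B ∈ (ℕ → Pred ℕ ℓ) ]
    (∀ i j → i ≢ j → B i ⊥ B j) ×
    ⋃ ℕ B ≐ A ×
    (∀ i → PPRich (B i)))
theorem5p7 =
  (λ A A⊆ℕ⁺ rich →
    let open AlmostDisjointFamily A⊆ℕ⁺ (Construction.blocks {A = A} rich) in
    F , F-cong , (λ {σ} {τ} → F-injective {σ} {τ}) , almostDisjoint , F⊆A , F-rich) ,
  (λ A _ rich →
    let open Splitting (Construction.blocks {A = A} rich) in
    Part , Part-disjoint , ⋃Part≐A , Part-rich)
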